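{- For every tree $T$ with at least one edge, $sr(T)=\lceil \Delta(T)/2\rceil$, where $\Delta(T)$ is the maximum degree of $T$.
   Context: All graphs are finite, simple and undirected. For a set $E'$ of edges of a graph, the subgraph induced by $E'$ is the graph whose edge set is $E'$ and whose vertex set is the set of endpoints of edges in $E'$. A graph is semiregular (a $[d,d+1]$-graph) if there is an integer $d$ such that every vertex has degree $d$ or $d+1$. The semiregular number $sr(G)$ of a graph $G$ is the minimum number of subsets into which $E(G)$ can be partitioned so that the subgraph induced by each subset is semiregular. -}

module Defs where

open import Data.Fin.Base using (Fin)
open import Data.Fin.Subset using (Subset; _∈_; _∉_; ∣_∣; Nonempty)
open import Data.Fin.Subset.Properties using (_∈?_; nonempty?)
open import Data.Integer.Base as ℤ using (ℤ; +_; 1ℤ)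
open import Data.List.Base using (List; _∷_; _++_; [_]; length; map; filter; allFin)
open import Data.List.Extrema.Nat using (max)
open import Data.List.Relation.Unary.Linked using (Linked)
open import Data.List.Relation.Unary.Unique.Propositional using (Unique)
open import Data.Nat.Base using (ℕ; _≤_)
open import Data.Product.Base using (Σ; ∃; ∃₂; _×_; _,_)
open import Data.Sum.Base using (_⊎_)
open import Data.Vec.Base using (tabulate)
open import Data.Vec.Properties using (lookup∘tabulate; lookup⇒[]=)
open import Relation.Binary.Construct.Closure.ReflexiveTransitive using (Star)
open import Relation.Binary.PropositionalEquality using (_≡_; trans)
open import Relation.Nullary using (¬_)
open import Relation.Nullary.Decidable using (does; dec-true)

-- A set of two-element subsets {u , v} of Fin n, stored as neighbourhoods:
-- {u , v} belongs to the set iff v ∈ nbrs u.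
record EdgeSet (n : ℕ) : Set where
  field
    nbrs   : Fin n → Subset n
    symm   : ∀ {u v} → v ∈ nbrs u → u ∈ nbrs v
    irrefl : ∀ {v} → v ∉ nbrs v

open EdgeSet public using (nbrs)

Joins : ∀ {n} → EdgeSet n → Fin n → Fin n → Set
Joins E u v = v ∈ nbrs E u

NonemptyE : ∀ {n} → EdgeSet n → Set
NonemptyE E = ∃₂ λ u v → Joins E u v

-- A finite simple graph.  The vertex set is an arbitrary subset of Fin n, so
-- that a graph and its subgraphs share the same ambient type.
record Graph (n : ℕ) : Set where
  field
    vertices : Subset n
    edges    : EdgeSet n
    incident : ∀ {u v} → Joins edges u v → u ∈ vertices

open Graph public

Adj : ∀ {n} → Graph n → Fin n → Fin n → Set
Adj G = Joins (edges G)

degree : ∀ {n} → Graph n → Fin n → ℕ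
degree G v = ∣ nbrs (edges G) v ∣

Δ : ∀ {n} → Graph n → ℕ
Δ {n} G = max 0 (map (degree G) (filter (_∈? vertices G) (allFin n)))

endpoints : ∀ {n} → EdgeSet n → Subset n
endpoints E = tabulate λ u → does (nonempty? (nbrs E u))

joins⇒endpoint : ∀ {n} (E : EdgeSet n) {u v} → Joins E u v → u ∈ endpoints E
joins⇒endpoint E {u} {v} uv = lookup⇒[]= u (endpoints E)
  (trans (lookup∘tabulate _ u) (dec-true (nonempty? (nbrs E u)) (v , uv)))

induced : ∀ {n} → EdgeSet n → Graph n
induced E = record
  { vertices = endpoints E
  ; edges    = E
  ; incident = joins⇒endpoint E
  }

Semiregular : ∀ {n} → Graph n → Set
Semiregular G = Σ ℤ λ d → ∀ v → v ∈ vertices G →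
  (+ degree G v ≡ d) ⊎ (+ degree G v ≡ d ℤ.+ 1ℤ)

record Partition {n} (E : EdgeSet n) (k : ℕ) : Set where
  field
    part     : Fin k → EdgeSet n
    nonempty : ∀ i → NonemptyE (part i)
    contained : ∀ i {u v} → Joins (part i) u v → Joins E u v
    covering : ∀ {u v} → Joins E u v → ∃ λ i → Joins (part i) u v
    disjoint : ∀ {i j u v} → Joins (part i) u v → Joins (part j) u v → i ≡ j

SemiregularPartition : ∀ {n} → Graph n → ℕ → Set
SemiregularPartition G k = Σ (Partition (edges G) k) λ P →
  ∀ i → Semiregular (induced (Partition.part P i))

-- sr(G) = k, i.e. k is the minimum of the set of sizes of such partitions.
sr[_]≡_ : ∀ {n} → Graph n → ℕ → Set
sr[ G ]≡ k = SemiregularPartition G k × (∀ m → SemiregularPartition G m → k ≤ m)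

infix 4 sr[_]≡_

Connected : ∀ {n} → Graph n → Set
Connected G = ∀ u v → u ∈ vertices G → v ∈ vertices G → Star (Adj G) u v

-- The cycle visits start, then rest in order, then returns to start.
record Cycle {n} (G : Graph n) : Set where
  field
    start    : Fin n
    rest     : List (Fin n)
    distinct : Unique (start ∷ rest)
    long     : 3 ≤ length (start ∷ rest)
    closed   : Linked (Adj G) (start ∷ rest ++ [ start ])

record IsTree {n} (G : Graph n) : Set where
  field
    inhabited : Nonempty (vertices G)
    connected : Connected G
    acyclic   : ¬ Cycle G

{-# OPTIONS --safe #-}
-- A nonempty forest has a leaf (the end of a maximal path).  For the lower
-- bound, a leaf of a semiregular part forces its degrees to lie in {0 , 1} or
-- {1 , 2}, so each part covers at most two of the edges at a given vertex.  For
-- the upper bound, delete a leaf, colour the rest with ⌈Δ/2⌉ colours using no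
-- colour more than twice at a vertex, and give the pendant edge a colour that
-- is used at most once at its other end.
module Submission where

open import Defs
open import Data.Nat.Base
  using (ℕ; zero; suc; _+_; _*_; _≤_; _<_; z≤n; s≤s; ⌈_/2⌉)

open import Data.Fin.Base using (Fin; zero; suc; punchIn; punchOut)
open import Data.Fin.Properties using (_≟_; any?; 0≢1+n; suc-injective; punchIn-punchOut)
open import Data.Fin.Subset
  using (Subset; inside; outside; _∈_; _⊆_; _⊂_; _∩_; _∪_; ∁; ⊤; ⁅_⁆; ∣_∣; Empty)
open import Data.Fin.Subset.Induction using (⊂-wellFounded)
open import Data.Fin.Subset.Properties
open import Data.Integer.Base as ℤ using (+_; 1ℤ)
import Data.Integer.Properties as ℤ
import Algebra.Properties.AbelianGroup ℤ.+-0-abelianGroup as ℤ-Group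
open import Data.List.Base using (List; []; _∷_; _++_; [_]; length; filter; allFin)
open import Data.List.Extrema.Nat using (xs≤max; max≤v⁺)
import Data.List.Membership.DecPropositional as DecMembership
open import Data.List.Membership.Propositional using () renaming (_∉_ to _∉ˡ_)
open import Data.List.Membership.Propositional.Properties
  using (∈-map⁺; ∈-filter⁺; ∈-allFin; ∈-∃++)
open import Data.List.Properties using (length-++; ++-assoc)
open import Data.List.Relation.Unary.All as All using (All; []; _∷_)
import Data.List.Relation.Unary.All.Properties as All
open import Data.List.Relation.Unary.AllPairs using (AllPairs; []; _∷_)
open import Data.List.Relation.Unary.Any using (here; there)
open import Data.List.Relation.Unary.Linked as Linked using (Linked; [-]; _∷_)
open import Data.List.Relation.Unary.Unique.Propositional using (Unique)
open import Data.Nat.Properties hiding (_≟_; suc-injective; 0≢1+n)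
open import Data.Product.Base using (Σ; ∃; _×_; _,_; proj₁; proj₂)
open import Data.Sum.Base using (_⊎_; inj₁; inj₂)
open import Data.Vec.Base using (tabulate; []; _∷_)
open import Data.Vec.Properties using (lookup∘tabulate; lookup⇒[]=; []=⇒lookup)
open import Function.Base using (_∘_)
open import Induction.WellFounded using (Acc; acc)
open import Level using (Level; 0ℓ)
open import Relation.Binary.Core using (Rel)
open import Relation.Binary.Definitions using (Symmetric) renaming (Decidable to Decidable₂)
open import Relation.Binary.PropositionalEquality
  using (_≡_; _≢_; refl; sym; trans; cong; subst)
open import Relation.Nullary using (¬_; Dec; yes; no; contradiction)
open import Relation.Nullary.Decidable
  using (does; dec-true; dec-false; decidable-stable; _×-dec_; ¬?)
open import Relation.Unary using (Decidable)

private
  variable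
    a r : Level
    A : Set a
    n : ℕ

-- Finite subsets: comprehension and counting.

select : ∀ {P : Fin n → Set} → Decidable P → Subset n
select P? = tabulate (does ∘ P?)

∈-select⁺ : ∀ {P : Fin n → Set} (P? : Decidable P) {x} → P x → x ∈ select P?
∈-select⁺ P? {x} px =
  lookup⇒[]= x _ (trans (lookup∘tabulate _ x) (dec-true (P? x) px))

∈-select⁻ : ∀ {P : Fin n → Set} (P? : Decidable P) {x} → x ∈ select P? → P x
∈-select⁻ P? {x} x∈ = decidable-stable (P? x) λ ¬px →
  contradiction
    (trans (sym (dec-false (P? x) ¬px))
           (trans (sym (lookup∘tabulate _ x)) ([]=⇒lookup x∈)))
    λ ()

∣p∩q∣+∣p∩∁q∣≡∣p∣ : ∀ (p q : Subset n) → ∣ p ∩ q ∣ + ∣ p ∩ ∁ q ∣ ≡ ∣ p ∣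
∣p∩q∣+∣p∩∁q∣≡∣p∣ []            []            = refl
∣p∩q∣+∣p∩∁q∣≡∣p∣ (outside ∷ p) (_       ∷ q) = ∣p∩q∣+∣p∩∁q∣≡∣p∣ p q
∣p∩q∣+∣p∩∁q∣≡∣p∣ (inside  ∷ p) (inside  ∷ q) = cong suc (∣p∩q∣+∣p∩∁q∣≡∣p∣ p q)
∣p∩q∣+∣p∩∁q∣≡∣p∣ (inside  ∷ p) (outside ∷ q) =
  trans (+-suc _ _) (cong suc (∣p∩q∣+∣p∩∁q∣≡∣p∣ p q))

∣p∪q∣≤∣p∣+∣q∣ : ∀ (p q : Subset n) → ∣ p ∪ q ∣ ≤ ∣ p ∣ + ∣ q ∣
∣p∪q∣≤∣p∣+∣q∣ p q = begin
  ∣ p ∪ q ∣                              ≡⟨ ∣p∩q∣+∣p∩∁q∣≡∣p∣ (p ∪ q) p ⟨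
  ∣ (p ∪ q) ∩ p ∣ + ∣ (p ∪ q) ∩ ∁ p ∣  ≤⟨ +-mono-≤ (∣p∩q∣≤∣q∣ (p ∪ q) p) (p⊆q⇒∣p∣≤∣q∣ rest⊆q) ⟩
  ∣ p ∣ + ∣ q ∣                          ∎
  where
  open ≤-Reasoning
  rest⊆q : (p ∪ q) ∩ ∁ p ⊆ q
  rest⊆q x∈ with x∈p∪q , x∈∁p ← x∈p∩q⁻ (p ∪ q) (∁ p) x∈ with x∈p∪q⁻ p q x∈p∪q
  ... | inj₁ x∈p = contradiction x∈p (x∈∁p⇒x∉p x∈∁p)
  ... | inj₂ x∈q = x∈q

Empty⇒∣p∣≡0 : ∀ {p : Subset n} → Empty p → ∣ p ∣ ≡ 0
Empty⇒∣p∣≡0 {n} p-empty = trans (cong ∣_∣ (Empty-unique p-empty)) (∣⊥∣≡0 n)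

x∈p⇒0<∣p∣ : ∀ {p : Subset n} {x} → x ∈ p → 0 < ∣ p ∣
x∈p⇒0<∣p∣ {p = p} {x} x∈p = subst (_≤ ∣ p ∣) (∣⁅x⁆∣≡1 x)
  (p⊆q⇒∣p∣≤∣q∣ λ y∈ → subst (_∈ p) (sym (x∈⁅y⁆⇒x≡y x y∈)) x∈p)

-- Union bound, by induction on `k`: whatever part of `p` lies outside `S zero` is covered by the
-- remaining sets.
covered⇒∣p∣≤k*m : ∀ {k m} (S : Fin k → Subset n) {p : Subset n} →
  (∀ {x} → x ∈ p → ∃ λ i → x ∈ S i) → (∀ i → ∣ S i ∣ ≤ m) → ∣ p ∣ ≤ k * m
covered⇒∣p∣≤k*m {k = zero} S cover small =
  ≤-reflexive (Empty⇒∣p∣≡0 λ (_ , x∈p) → contradiction (proj₁ (cover x∈p)) λ ())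
covered⇒∣p∣≤k*m {k = suc k} {m} S {p} cover small = begin
  ∣ p ∣                                    ≡⟨ ∣p∩q∣+∣p∩∁q∣≡∣p∣ p (S zero) ⟨
  ∣ p ∩ S zero ∣ + ∣ p ∩ ∁ (S zero) ∣    ≤⟨ +-mono-≤ (≤-trans (∣p∩q∣≤∣q∣ p (S zero)) (small zero))
                                                (covered⇒∣p∣≤k*m (S ∘ suc) cover′ (small ∘ suc)) ⟩
  m + k * m                                ∎
  where
  open ≤-Reasoning
  cover′ : ∀ {x} → x ∈ p ∩ ∁ (S zero) → ∃ λ i → x ∈ S (suc i)
  cover′ x∈ with x∈p , x∈∁S₀ ← x∈p∩q⁻ p _ x∈ with cover x∈p
  ... | zero  , x∈S₀ = contradiction x∈S₀ (x∈∁p⇒x∉p x∈∁S₀)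
  ... | suc i , x∈Sᵢ = i , x∈Sᵢ

-- By disjointness the later sets all fit into `p ∩ ∁ (S zero)`, where the induction hypothesis
-- applies.
disjoint⇒k*m≤∣p∣ : ∀ {k m} (S : Fin k → Subset n) {p : Subset n} →
  (∀ i → S i ⊆ p) → (∀ {i j x} → x ∈ S i → x ∈ S j → i ≡ j) →
  (∀ i → m ≤ ∣ S i ∣) → k * m ≤ ∣ p ∣
disjoint⇒k*m≤∣p∣ {k = zero} S sub disj large = z≤n
disjoint⇒k*m≤∣p∣ {k = suc k} {m} S {p} sub disj large = begin
  m + k * m                                ≤⟨ +-mono-≤ (≤-trans (large zero) (p⊆q⇒∣p∣≤∣q∣ S₀⊆))
                                                (disjoint⇒k*m≤∣p∣ (S ∘ suc) sub′ disj′ (large ∘ suc)) ⟩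
  ∣ p ∩ S zero ∣ + ∣ p ∩ ∁ (S zero) ∣    ≡⟨ ∣p∩q∣+∣p∩∁q∣≡∣p∣ p (S zero) ⟩
  ∣ p ∣                                    ∎
  where
  open ≤-Reasoning
  S₀⊆ : S zero ⊆ p ∩ S zero
  S₀⊆ x∈ = x∈p∩q⁺ (sub zero x∈ , x∈)
  sub′ : ∀ i → S (suc i) ⊆ p ∩ ∁ (S zero)
  sub′ i x∈ = x∈p∩q⁺ (sub (suc i) x∈ , x∉p⇒x∈∁p λ x∈S₀ → 0≢1+n (disj x∈S₀ x∈))
  disj′ : ∀ {i j x} → x ∈ S (suc i) → x ∈ S (suc j) → i ≡ j
  disj′ x∈ y∈ = suc-injective (disj x∈ y∈)

-- Pigeonhole: if every `S i` had at least `suc m` elements, disjointness would force `k * suc m` of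
-- them into `p`.
∃-small-part : ∀ {k m} (S : Fin k → Subset n) {p : Subset n} →
  (∀ i → S i ⊆ p) → (∀ {i j x} → x ∈ S i → x ∈ S j → i ≡ j) →
  ∣ p ∣ < k * suc m → ∃ λ i → ∣ S i ∣ ≤ m
∃-small-part {m = m} S sub disj p<km = decidable-stable (any? λ i → ∣ S i ∣ ≤? m) λ none →
  <⇒≱ p<km (disjoint⇒k*m≤∣p∣ S sub disj λ i → ≰⇒> λ Sᵢ≤m → none (i , Sᵢ≤m))

-- Edge sets and their restrictions.

restrict : EdgeSet n → {R : Rel (Fin n) 0ℓ} → Decidable₂ R → Symmetric R → EdgeSet n
restrict E R? R-sym = record
  { nbrs   = λ u → select (λ v → (v ∈? nbrs E u) ×-dec R? u v)
  ; symm   = λ {u} {v} v∈ →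
      let uv , Ruv = ∈-select⁻ (λ v → (v ∈? nbrs E u) ×-dec R? u v) v∈
      in ∈-select⁺ (λ u → (u ∈? nbrs E v) ×-dec R? v u) (EdgeSet.symm E uv , R-sym Ruv)
  ; irrefl = λ {v} v∈ →
      EdgeSet.irrefl E (proj₁ (∈-select⁻ (λ w → (w ∈? nbrs E v) ×-dec R? v w) v∈))
  }

module _ (E : EdgeSet n) {R : Rel (Fin n) 0ℓ} (R? : Decidable₂ R) (R-sym : Symmetric R) {u v : Fin n} where

  restrict⁺ : Joins E u v → R u v → Joins (restrict E R? R-sym) u v
  restrict⁺ uv Ruv = ∈-select⁺ (λ v → (v ∈? nbrs E u) ×-dec R? u v) (uv , Ruv)

  restrict⁻ : Joins (restrict E R? R-sym) u v → Joins E u v × R u v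
  restrict⁻ = ∈-select⁻ (λ v → (v ∈? nbrs E u) ×-dec R? u v)

endpoint⇒joins : ∀ (E : EdgeSet n) {u} → u ∈ endpoints E → ∃ (Joins E u)
endpoint⇒joins E = ∈-select⁻ (λ u → nonempty? (nbrs E u))

nonemptyE? : (E : EdgeSet n) → Dec (NonemptyE E)
nonemptyE? E = any? λ u → nonempty? (nbrs E u)

-- Cycles and leaves in forests.

Acyclic : EdgeSet n → Set
Acyclic E = ¬ Cycle (induced E)

cycle-map : ∀ {G H : Graph n} → (∀ {u v} → Adj G u v → Adj H u v) → Cycle G → Cycle H
cycle-map G⊆H c = record
  { start    = start
  ; rest     = rest
  ; distinct = distinct
  ; long     = long
  ; closed   = Linked.map G⊆H closed
  }
  where open Cycle c

acyclic-⊆ : ∀ {E F : EdgeSet n} → (∀ {u v} → Joins F u v → Joins E u v) → Acyclic E → Acyclic F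
acyclic-⊆ F⊆E acyclic = acyclic ∘ cycle-map F⊆E

AllPairs-++⁻ˡ : ∀ {R : Rel A r} xs {ys} → AllPairs R (xs ++ ys) → AllPairs R xs
AllPairs-++⁻ˡ []       _        = []
AllPairs-++⁻ˡ (x ∷ xs) (p ∷ ps) = All.++⁻ˡ xs p ∷ AllPairs-++⁻ˡ xs ps

-- Serves to close up a path at `y`: `x` will be the first vertex of the path, and whatever follows
-- `y` is discarded.
Linked-redirect : ∀ {R : Rel A r} xs {y zs x} →
  Linked R (xs ++ y ∷ zs) → R y x → Linked R ((xs ++ [ y ]) ++ [ x ])
Linked-redirect []           _       yx = yx ∷ [-]
Linked-redirect (_ ∷ [])     (p ∷ l) yx = p ∷ Linked-redirect [] l yx
Linked-redirect (_ ∷ z ∷ xs) (p ∷ l) yx = p ∷ Linked-redirect (z ∷ xs) l yx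

-- The cycle is the segment from `x` to `y` followed by the edge back. Since `x′` lies strictly
-- between them, it has at least three vertices.
close-path : ∀ (G : Graph n) {x x′ y} as {bs} → let path = x ∷ x′ ∷ as ++ y ∷ bs in
  Unique path → Linked (Adj G) path → Adj G y x → Cycle G
close-path G {x} {x′} {y} as {bs} unique linked yx = record
  { start    = x
  ; rest     = x′ ∷ as ++ [ y ]
  ; distinct = AllPairs-++⁻ˡ (x ∷ x′ ∷ as ++ [ y ])
      (subst (λ zs → Unique (x ∷ x′ ∷ zs)) (sym (++-assoc as [ y ] bs)) unique)
  ; long     = s≤s (s≤s (subst (1 ≤_) (sym (length-++ as)) (m≤n+m 1 (length as))))
  ; closed   = Linked-redirect (x ∷ x′ ∷ as) linked yx
  }

record Leaf (E : EdgeSet n) : Set where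
  field
    leaf nbr : Fin n
    joins    : Joins E leaf nbr
    unique   : ∀ {v} → Joins E leaf v → v ≡ nbr

module _ {n} (E : EdgeSet n) (acyclic : Acyclic E) where

  open DecMembership (_≟_ {n}) using () renaming (_∈?_ to _∈ˡ?_)

  -- U contains the vertices not yet visited; it shrinks with each step.
  maximal-path : ∀ {U : Subset n} → Acc _⊂_ U → ∀ x x′ xs → let path = x ∷ x′ ∷ xs in
    Unique path → Linked (Joins E) path → (∀ {z} → z ∉ˡ path → z ∈ U) → Leaf E
  maximal-path (acc rec) x x′ xs unique linked unvisited
    -- The path is grown at its head. When `x′` is the only neighbour of `x`, the head is the
    -- desired leaf.
    with any? (λ y → (y ∈? nbrs E x) ×-dec ¬? (y ≟ x′))
  ... | no none = record
    { leaf   = x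
    ; nbr    = x′
    ; joins  = Linked.head linked
    ; unique = λ {v} xv → decidable-stable (v ≟ x′) λ v≢x′ → none (v , xv , v≢x′)
    }
  ... | yes (y , xy , y≢x′) with y ∈ˡ? xs
  -- The new neighbour already lies on the path beyond `x′`, so its edge to `x` closes a cycle.
  ...   | yes y∈xs with as , bs , refl ← ∈-∃++ y∈xs =
          contradiction (close-path (induced E) as unique linked (EdgeSet.symm E xy)) acyclic
  ...   | no y∉xs =
          maximal-path (rec (x∈p⇒p-x⊂p (unvisited y∉path))) y x (x′ ∷ xs)
            (All.¬Any⇒All¬ _ y∉path ∷ unique)
            (EdgeSet.symm E xy ∷ linked)
            λ z∉ → x∈p∧x≢y⇒x∈p-y (unvisited (z∉ ∘ there)) (z∉ ∘ here)
    where
    y∉path : y ∉ˡ x ∷ x′ ∷ xs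
    y∉path (here refl)           = EdgeSet.irrefl E xy
    y∉path (there (here y≡x′))   = y≢x′ y≡x′
    y∉path (there (there y∈xs)) = y∉xs y∈xs

  acyclic⇒leaf : NonemptyE E → Leaf E
  acyclic⇒leaf (u , v , uv) = maximal-path (⊂-wellFounded ⊤) u v []
    ((u≢v ∷ []) ∷ [] ∷ []) (uv ∷ [-]) (λ _ → ∈⊤)
    where
    u≢v : u ≢ v
    u≢v refl = EdgeSet.irrefl E uv

-- Degrees in semiregular forests.

leaf-degree : ∀ {E : EdgeSet n} (l : Leaf E) → ∣ nbrs E (Leaf.leaf l) ∣ ≡ 1
leaf-degree {E = E} l = ≤-antisym
  (subst (∣ nbrs E leaf ∣ ≤_) (∣⁅x⁆∣≡1 nbr)
    (p⊆q⇒∣p∣≤∣q∣ λ v∈ → subst (_∈ ⁅ nbr ⁆) (sym (unique v∈)) (x∈⁅x⁆ nbr)))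
  (x∈p⇒0<∣p∣ joins)
  where open Leaf l

semiregular⇒degree≤2 : ∀ {E : EdgeSet n} → Acyclic E → NonemptyE E → Semiregular (induced E) →
  ∀ v → ∣ nbrs E v ∣ ≤ 2
semiregular⇒degree≤2 {E = E} acyclic ne (d , regular) v with nonempty? (nbrs E v)
-- Semiregularity constrains only the endpoints of `E`; any other vertex has degree 0.
... | no  v-isolated = ≤-trans (≤-reflexive (Empty⇒∣p∣≡0 v-isolated)) z≤n
... | yes (_ , vw)   = bound (regular′ (Leaf.joins l)) (regular v (joins⇒endpoint E vw))
  where
  l = acyclic⇒leaf E acyclic ne
  regular′ : ∀ {w} → Joins E (Leaf.leaf l) w → (+ 1 ≡ d) ⊎ (+ 1 ≡ d ℤ.+ 1ℤ)
  regular′ lw = subst (λ k → (+ k ≡ d) ⊎ (+ k ≡ d ℤ.+ 1ℤ)) (leaf-degree l)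
    (regular (Leaf.leaf l) (joins⇒endpoint E lw))
  -- The leaf, of degree 1, leaves only `d = 1`, with degrees 1 and 2, or `d = 0`, with degrees 0
  -- and 1.
  bound : ∀ {k} → (+ 1 ≡ d) ⊎ (+ 1 ≡ d ℤ.+ 1ℤ) → (+ k ≡ d) ⊎ (+ k ≡ d ℤ.+ 1ℤ) → k ≤ 2
  bound (inj₁ refl) (inj₁ refl) = s≤s z≤n
  bound (inj₁ refl) (inj₂ refl) = ≤-refl
  bound (inj₂ 1≡d+1) (inj₁ k≡d) = ≤-trans (≤-reflexive (ℤ.+-injective (trans k≡d d≡0))) z≤n
    where
    d≡0 : d ≡ + 0
    d≡0 = sym (ℤ-Group.∙-cancelʳ 1ℤ (+ 0) d 1≡d+1)
  bound (inj₂ 1≡d+1) (inj₂ k≡d+1) =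
    ≤-trans (≤-reflexive (ℤ.+-injective (trans k≡d+1 (sym 1≡d+1)))) (s≤s z≤n)

degree≤2⇒semiregular : ∀ (E : EdgeSet n) → (∀ v → ∣ nbrs E v ∣ ≤ 2) → Semiregular (induced E)
-- The choice `d = 1` works because an endpoint has at least one neighbour.
degree≤2⇒semiregular E bound = 1ℤ , λ v v∈ →
  1or2 (x∈p⇒0<∣p∣ (proj₂ (endpoint⇒joins E v∈))) (bound v)
  where
  1or2 : ∀ {k} → 0 < k → k ≤ 2 → (+ k ≡ 1ℤ) ⊎ (+ k ≡ + 2)
  1or2 {1} _ _ = inj₁ refl
  1or2 {2} _ _ = inj₂ refl
  1or2 {suc (suc (suc _))} _ (s≤s (s≤s ()))

-- Edge colourings and recolouring at a vertex.

record Colouring (n k : ℕ) : Set where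
  field
    -- Every pair of vertices gets a colour, edge or not, so one colouring can be read both on `E`
    -- and on `E` with a leaf deleted.
    colour      : Fin n → Fin n → Fin k
    colour-comm : ∀ u v → colour u v ≡ colour v u

open Colouring

sameColour-sym : ∀ {k} (C : Colouring n k) {i} → Symmetric (λ u v → colour C u v ≡ i)
sameColour-sym C {x = u} {y = v} uv≡i = trans (colour-comm C v u) uv≡i

colourClass : ∀ {k} → EdgeSet n → Colouring n k → Fin k → EdgeSet n
colourClass E C i = restrict E (λ u v → colour C u v ≟ i) (sameColour-sym C)

module _ {k} (E : EdgeSet n) (C : Colouring n k) {i : Fin k} {u v : Fin n} where

  colourClass⁺ : Joins E u v → colour C u v ≡ i → Joins (colourClass E C i) u v
  colourClass⁺ = restrict⁺ E (λ u v → colour C u v ≟ i) (sameColour-sym C)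

  colourClass⁻ : Joins (colourClass E C i) u v → Joins E u v × colour C u v ≡ i
  colourClass⁻ = restrict⁻ E (λ u v → colour C u v ≟ i) (sameColour-sym C)

module _ {k} (C : Colouring n k) (u : Fin n) (c : Fin k) where

  private
    -- The two decisions are arguments so that swapping the vertices merely swaps them, and
    -- commutativity becomes a case split.
    recolour-fun : ∀ {x y} → Dec (x ≡ u) → Dec (y ≡ u) → Fin k
    recolour-fun         (yes _) _       = c
    recolour-fun         (no  _) (yes _) = c
    recolour-fun {x} {y} (no  _) (no  _) = colour C x y

    recolour-comm : ∀ {x y} (p : Dec (x ≡ u)) (q : Dec (y ≡ u)) →
      recolour-fun p q ≡ recolour-fun q p
    recolour-comm         (yes _) (yes _) = refl
    recolour-comm         (yes _) (no  _) = refl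
    recolour-comm         (no  _) (yes _) = refl
    recolour-comm {x} {y} (no  _) (no  _) = colour-comm C x y

  -- Opaque so that with-abstraction over a decision v ≟ u does not reach inside it.
  opaque
    recolour : Colouring n k
    recolour = record
      { colour      = λ x y → recolour-fun (x ≟ u) (y ≟ u)
      ; colour-comm = λ x y → recolour-comm (x ≟ u) (y ≟ u)
      }

    recolour-at : ∀ x → colour recolour x u ≡ c
    recolour-at x with x ≟ u | u ≟ u
    ... | yes _ | _       = refl
    ... | no  _ | yes _   = refl
    ... | no  _ | no  u≢u = contradiction refl u≢u

    recolour-away : ∀ {x y} → x ≢ u → y ≢ u → colour recolour x y ≡ colour C x y
    recolour-away {x} {y} x≢u y≢u with x ≟ u | y ≟ u
    ... | yes x≡u | _       = contradiction x≡u x≢u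
    ... | no  _   | yes y≡u = contradiction y≡u y≢u
    ... | no  _   | no  _   = refl

-- For `m = 1` these are the proper edge colourings with `k` colours; the semiregular number calls
-- for `m = 2`.
BoundedColouring : EdgeSet n → ℕ → ℕ → Set
BoundedColouring {n} E k m = Σ (Colouring n k) λ C → ∀ i v → ∣ nbrs (colourClass E C i) v ∣ ≤ m

-- Deleting a leaf and extending a colouring.

module _ {n} (E : EdgeSet n) (l : Leaf E) where

  open Leaf l

  private
    avoids? : Decidable₂ (λ x y → x ≢ leaf × y ≢ leaf)
    avoids? x y = ¬? (x ≟ leaf) ×-dec ¬? (y ≟ leaf)

    avoids-sym : Symmetric (λ x y → x ≢ leaf × y ≢ leaf)
    avoids-sym (x≢ , y≢) = y≢ , x≢

  deleteLeaf : EdgeSet n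
  deleteLeaf = restrict E avoids? avoids-sym

  deleteLeaf⁺ : ∀ {x y} → Joins E x y → x ≢ leaf → y ≢ leaf → Joins deleteLeaf x y
  deleteLeaf⁺ xy x≢ y≢ = restrict⁺ E avoids? avoids-sym xy (x≢ , y≢)

  deleteLeaf⁻ : ∀ {x y} → Joins deleteLeaf x y → Joins E x y × x ≢ leaf × y ≢ leaf
  deleteLeaf⁻ = restrict⁻ E avoids? avoids-sym

  deleteLeaf-⊆ : ∀ {x y} → Joins deleteLeaf x y → Joins E x y
  deleteLeaf-⊆ = proj₁ ∘ deleteLeaf⁻

  -- The measure for the induction in `forest-colouring`: `leaf` itself ceases to be an endpoint.
  endpoints-deleteLeaf : endpoints deleteLeaf ⊂ endpoints E
  endpoints-deleteLeaf =
      (λ x∈ → joins⇒endpoint E (deleteLeaf-⊆ (proj₂ (endpoint⇒joins deleteLeaf x∈))))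
    , leaf , joins⇒endpoint E joins
    , λ leaf∈ → proj₁ (proj₂ (deleteLeaf⁻ (proj₂ (endpoint⇒joins deleteLeaf leaf∈)))) refl

  -- Without the pendant edge fewer than `k * suc m` edges meet `nbr`, so by pigeonhole some colour
  -- occurs at most `m` times there and can take one more edge.
  extend : ∀ {k m} → ∣ nbrs E nbr ∣ ≤ k * suc m →
    BoundedColouring deleteLeaf k (suc m) → BoundedColouring E k (suc m)
  extend {k} {m} nbr-small (C , bounded) = C′ , bounded′
    where
    leaf∈nbr : Joins E nbr leaf
    leaf∈nbr = EdgeSet.symm E joins

    shrinks : nbrs deleteLeaf nbr ⊂ nbrs E nbr
    shrinks = deleteLeaf-⊆ , leaf , leaf∈nbr , λ leaf∈ → proj₂ (proj₂ (deleteLeaf⁻ leaf∈)) refl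

    free : ∃ λ i → ∣ nbrs (colourClass deleteLeaf C i) nbr ∣ ≤ m
    free = ∃-small-part (λ i → nbrs (colourClass deleteLeaf C i) nbr)
      (λ i x∈ → proj₁ (colourClass⁻ deleteLeaf C x∈))
      (λ x∈ y∈ → trans (sym (proj₂ (colourClass⁻ deleteLeaf C x∈))) (proj₂ (colourClass⁻ deleteLeaf C y∈)))
      (<-≤-trans (p⊂q⇒∣p∣<∣q∣ shrinks) nbr-small)

    c = proj₁ free
    -- This recolours all pairs at `leaf`, but the pendant edge is the only edge of `E` among them.
    C′ = recolour C leaf c

    retained : ∀ {i v x} → v ≢ leaf → x ≢ leaf →
      x ∈ nbrs (colourClass E C′ i) v → x ∈ nbrs (colourClass deleteLeaf C i) v
    retained v≢ x≢ x∈ with vx , vx≡i ← colourClass⁻ E C′ x∈ =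
      colourClass⁺ deleteLeaf C (deleteLeaf⁺ vx v≢ x≢)
        (trans (sym (recolour-away C leaf c v≢ x≢)) vx≡i)

    bounded′ : ∀ i v → ∣ nbrs (colourClass E C′ i) v ∣ ≤ suc m
    bounded′ i v with v ≟ leaf
    ... | yes refl = ≤-trans
      (p⊆q⇒∣p∣≤∣q∣ λ x∈ → proj₁ (colourClass⁻ E C′ x∈))
      (≤-trans (≤-reflexive (leaf-degree l)) (s≤s z≤n))
    ... | no v≢leaf with (v ≟ nbr) ×-dec (c ≟ i)
    -- Away from `leaf`, a class gains an edge only here, at `nbr` in colour `c`, where it had at
    -- most `m` before.
    ...   | yes (refl , refl) = begin
            ∣ nbrs (colourClass E C′ c) v ∣                       ≤⟨ p⊆q⇒∣p∣≤∣q∣ split ⟩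
            ∣ ⁅ leaf ⁆ ∪ nbrs (colourClass deleteLeaf C c) v ∣     ≤⟨ ∣p∪q∣≤∣p∣+∣q∣ ⁅ leaf ⁆ _ ⟩
            ∣ ⁅ leaf ⁆ ∣ + ∣ nbrs (colourClass deleteLeaf C c) v ∣ ≤⟨ +-mono-≤ (≤-reflexive (∣⁅x⁆∣≡1 leaf)) (proj₂ free) ⟩
            suc m                                                  ∎
      where
      open ≤-Reasoning
      split : nbrs (colourClass E C′ c) v ⊆ ⁅ leaf ⁆ ∪ nbrs (colourClass deleteLeaf C c) v
      split {x} x∈ with x ≟ leaf
      ... | yes refl   = x∈p∪q⁺ (inj₁ (x∈⁅x⁆ leaf))
      ... | no  x≢leaf = x∈p∪q⁺ (inj₂ (retained v≢leaf x≢leaf x∈))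
    -- An edge from `v` to `leaf` in class `i` would force `v` to be `nbr` and `i` to be `c`, so
    -- only old edges occur.
    ...   | no ¬pendant = ≤-trans (p⊆q⇒∣p∣≤∣q∣ λ x∈ → retained v≢leaf (x≢leaf x∈) x∈) (bounded i v)
      where
      x≢leaf : ∀ {x} → x ∈ nbrs (colourClass E C′ i) v → x ≢ leaf
      x≢leaf x∈ refl with vx , vx≡i ← colourClass⁻ E C′ x∈ =
        ¬pendant (unique (EdgeSet.symm E vx) , trans (sym (recolour-at C leaf c v)) vx≡i)

-- Induction on the set of endpoints, removing a leaf each time. The colour `c₀` fills the constant
-- colouring used once no edges remain.
forest-colouring : ∀ {k m} → Fin k → (E : EdgeSet n) → Acyclic E →
  (∀ v → ∣ nbrs E v ∣ ≤ k * suc m) → BoundedColouring E k (suc m)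
forest-colouring {n} {k} {m} c₀ E acyclic small = go E (⊂-wellFounded (endpoints E)) acyclic small
  where
  go : ∀ E → Acc _⊂_ (endpoints E) → Acyclic E →
    (∀ v → ∣ nbrs E v ∣ ≤ k * suc m) → BoundedColouring E k (suc m)
  go E (acc rec) acyclic small with nonemptyE? E
  ... | no empty = C₀ , λ i v → ≤-trans
      (≤-reflexive (Empty⇒∣p∣≡0 λ (w , w∈) → empty (v , w , proj₁ (colourClass⁻ E C₀ w∈)))) z≤n
    where
    C₀ : Colouring n k
    C₀ = record { colour = λ _ _ → c₀ ; colour-comm = λ _ _ → refl }
  ... | yes ne = extend E l (small _)
      (go (deleteLeaf E l) (rec (endpoints-deleteLeaf E l)) (acyclic-⊆ (deleteLeaf-⊆ E l) acyclic)
        λ v → ≤-trans (p⊆q⇒∣p∣≤∣q∣ (deleteLeaf-⊆ E l)) (small v))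
    where l = acyclic⇒leaf E acyclic ne

-- Maximum degree and rounding.

degree≤Δ : ∀ (G : Graph n) v → degree G v ≤ Δ G
degree≤Δ G v with nonempty? (nbrs (edges G) v)
-- `Δ` ranges over `vertices G` only. A `v` with a neighbour lies there by `incident`; without one
-- its degree is 0.
... | no  v-isolated = ≤-trans (≤-reflexive (Empty⇒∣p∣≡0 v-isolated)) z≤n
... | yes (_ , vw)   = All.lookup (xs≤max 0 _)
  (∈-map⁺ (degree G) (∈-filter⁺ (_∈? vertices G) (∈-allFin v) (incident G vw)))

Δ≤ : ∀ (G : Graph n) {d} → (∀ v → degree G v ≤ d) → Δ G ≤ d
Δ≤ G bound = max≤v⁺ z≤n (All.map⁺ (All.universal bound (filter (_∈? vertices G) (allFin _))))

⌈m*2/2⌉≡m : ∀ m → ⌈ m * 2 /2⌉ ≡ m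
⌈m*2/2⌉≡m zero    = refl
⌈m*2/2⌉≡m (suc m) = cong suc (⌈m*2/2⌉≡m m)

m≤⌈m/2⌉*2 : ∀ m → m ≤ ⌈ m /2⌉ * 2
m≤⌈m/2⌉*2 0             = z≤n
m≤⌈m/2⌉*2 1             = s≤s z≤n
m≤⌈m/2⌉*2 (suc (suc m)) = s≤s (s≤s (m≤⌈m/2⌉*2 m))

-- Together with `m≤⌈m/2⌉*2` this makes `⌈ m /2⌉` the least `n` with `m ≤ n * 2`.
⌈m/2⌉≤n : ∀ m {n} → m ≤ n * 2 → ⌈ m /2⌉ ≤ n
⌈m/2⌉≤n m {n} m≤n*2 = subst (⌈ m /2⌉ ≤_) (⌈m*2/2⌉≡m n) (⌈n/2⌉-mono m≤n*2)

-- The two bounds on the semiregular number.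

sr-lower : ∀ (T : Graph n) {m} → Acyclic (edges T) → SemiregularPartition T m → ⌈ Δ T /2⌉ ≤ m
sr-lower T acyclic (P , semiregular) = ⌈m/2⌉≤n (Δ T) (Δ≤ T λ v →
  -- The edges at `v` are shared out among `m` parts, each a forest with at most two of them; hence
  -- `Δ T ≤ m * 2`.
  covered⇒∣p∣≤k*m (λ i → nbrs (part i) v) covering λ i →
    semiregular⇒degree≤2 (acyclic-⊆ {E = edges T} {F = part i} (contained i) acyclic) (nonempty i) (semiregular i) v)
  where open Partition P

-- An unused colour could be dropped, leaving too few colours.
class-nonempty : ∀ {k} {E : EdgeSet n} (C : Colouring n k) →
  (∀ i v → ∣ nbrs (colourClass E C i) v ∣ ≤ 2) →
  (∀ {j} → (∀ v → ∣ nbrs E v ∣ ≤ j * 2) → k ≤ j) →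
  ∀ i → NonemptyE (colourClass E C i)
class-nonempty {k = suc k} {E} C bounded minimal i =
  decidable-stable (nonemptyE? (colourClass E C i)) λ unused →
    -- The `k` colours other than `i`, enumerated by `punchIn i`, cover all edges, so every degree
    -- is at most `k * 2` and minimality yields `suc k ≤ k`.
    1+n≰n (minimal λ v → covered⇒∣p∣≤k*m (λ j → nbrs (colourClass E C (punchIn i j)) v)
      (λ {w} vw →
        let i≢ : i ≢ colour C v w
            i≢ i≡ = unused (v , w , colourClass⁺ E C vw (sym i≡))
        in punchOut i≢ , colourClass⁺ E C vw (sym (punchIn-punchOut i≢)))
      (λ j → bounded (punchIn i j) v))

-- `Partition` demands nonempty parts, and this is what the minimality of `k` provides.
colouring⇒partition : ∀ {k} {E : EdgeSet n} → BoundedColouring E k 2 →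
  (∀ {j} → (∀ v → ∣ nbrs E v ∣ ≤ j * 2) → k ≤ j) → Partition E k
colouring⇒partition {E = E} (C , bounded) minimal = record
  { part      = colourClass E C
  ; nonempty  = class-nonempty {E = E} C bounded minimal
  ; contained = λ i uv → proj₁ (colourClass⁻ E C uv)
  ; covering  = λ {u} {v} uv → colour C u v , colourClass⁺ E C uv refl
  ; disjoint  = λ uv∈i uv∈j →
      trans (sym (proj₂ (colourClass⁻ E C uv∈i))) (proj₂ (colourClass⁻ E C uv∈j))
  }

sr-upper : ∀ (T : Graph n) → Acyclic (edges T) → NonemptyE (edges T) →
  SemiregularPartition T ⌈ Δ T /2⌉
sr-upper T acyclic (u , v , uv) =
  -- A bound `j * 2` on all degrees also bounds `Δ T`, so no `j` below `⌈ Δ T /2⌉` qualifies.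
  colouring⇒partition colouring (λ bound → ⌈m/2⌉≤n (Δ T) (Δ≤ T bound)) ,
  λ i → degree≤2⇒semiregular (colourClass (edges T) (proj₁ colouring) i) (proj₂ colouring i)
  where
  some : ∀ m → 0 < m → Fin ⌈ m /2⌉
  some (suc _) _ = zero
  colouring : BoundedColouring (edges T) ⌈ Δ T /2⌉ 2
  -- The edge at `u` makes `Δ T` positive, so there is a colour to start from.
  colouring = forest-colouring (some (Δ T) (<-≤-trans (x∈p⇒0<∣p∣ uv) (degree≤Δ T u))) (edges T) acyclic
    λ w → ≤-trans (degree≤Δ T w) (m≤⌈m/2⌉*2 (Δ T))

theorem3 : ∀ (n : ℕ) (T : Graph n) → IsTree T → NonemptyE (edges T) →
    sr[ T ]≡ ⌈ Δ T /2⌉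
theorem3 n T tree ne = sr-upper T acyclic ne , λ m → sr-lower T acyclic
  where
  acyclic : Acyclic (edges T)
  -- `induced (edges T)` and `T` have the same adjacency and can differ only in isolated vertices,
  -- so their cycles agree.
  acyclic = IsTree.acyclic tree ∘ cycle-map (λ uv → uv)
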